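{- Let $n\ge2$ and let $\mathbf A=(A,q,\mathsf e_1,\dots,\mathsf e_n)$ be an $n\mathrm{BA}$. A multideal of $\mathbf A$ is prime if and only if it is an ultramultideal.
   Context: Let $n\ge 2$. An $n\mathrm{BA}$ (Boolean-like algebra of dimension $n$) is an algebra $\mathbf A=(A,q,\mathsf e_1,\dots,\mathsf e_n)$ with $q$ of arity $n+1$ and constants $\mathsf e_1,\dots,\mathsf e_n$ satisfying the identities (B0) $q(\mathsf e_i,x^1,\dots,x^n)=x^i$ for $i=1,\dots,n$; (B1) $q(y,x,\dots,x)=x$; (B2) $q(y,q(y,x^{11},\dots,x^{1n}),\dots,q(y,x^{n1},\dots,x^{nn}))=q(y,x^{11},x^{22},\dots,x^{nn})$; (B3) $q(y,q(x^{10},\dots,x^{1n}),\dots,q(x^{n0},\dots,x^{nn}))=q(q(y,x^{10},\dots,x^{n0}),\dots,q(y,x^{1n},\dots,x^{nn}))$; (B4) $q(y,\mathsf e_1,\dots,\mathsf e_n)=y$. For $i\in\{1,\dots,n\}$, $x\land_i y=q(x,w_1,\dots,w_n)$ with $w_i=\mathsf e_i$ and $w_k=y$ for $k\ne i$. A multideal of $\mathbf A$ is a tuple $(I_1,\dots,I_n)$ of pairwise disjoint subsets of $A$ such that: (m1) $\mathsf e_k\in I_k$ for all $k$; (m2) if $a\in I_r$, $b\in I_k$ and $y_1,\dots,y_n\in A$, then $q(a,y_1,\dots,y_{r-1},b,y_{r+1},\dots,y_n)\in I_k$; (m3) if $a\in A$ and $y_1,\dots,y_n\in I_k$, then $q(a,y_1,\dots,y_n)\in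 I_k$. An ultramultideal is a multideal with $I_1\cup\dots\cup I_n=A$. A multideal $(I_1,\dots,I_n)$ is prime if, for every $i\in\{1,\dots,n\}$ and all $x,y\in A$, $x\land_i y\in I_i$ implies $x\in I_i$ or $y\in I_i$. -}

module Defs where

open import Level using (Level; suc; _⊔_)
open import Data.Nat.Base using (ℕ)
open import Data.Fin.Base using (Fin)
open import Data.Sum.Base using (_⊎_)
open import Data.Vec.Functional using (Vector; replicate; updateAt)
open import Data.Vec.Functional.Relation.Binary.Pointwise using (Pointwise)
open import Function.Base using (const)
open import Relation.Binary.Core using (Rel)
open import Relation.Binary.Structures using (IsEquivalence)
open import Relation.Binary.Definitions using (_Respects_)
open import Relation.Binary.PropositionalEquality.Core using (_≢_)
open import Relation.Unary using (Pred; _∈_; _⊥_; ⋃; Universal)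

-- Boolean-like algebras of dimension n.  As in Algebra.Bundles, equality is
-- a setoid equality _≈_ and q is required to be a congruence for it.  The
-- indices 1, …, n are the elements of Fin n, and the (n+1)-ary operation q
-- takes its first argument separately from the vector of the other n.

record nBA (n : ℕ) (c ℓ : Level) : Set (suc (c ⊔ ℓ)) where
  infix 4 _≈_
  field
    Carrier       : Set c
    _≈_           : Rel Carrier ℓ
    isEquivalence : IsEquivalence _≈_
    q             : Carrier → Vector Carrier n → Carrier
    e             : Vector Carrier n
    q-cong        : ∀ {y y′ xs xs′} → y ≈ y′ → Pointwise _≈_ xs xs′ →
                    q y xs ≈ q y′ xs′
    B0            : ∀ i (x : Vector Carrier n) → q (e i) x ≈ x i
    B1            : ∀ y x → q y (replicate n x) ≈ x
    B2            : ∀ y (x : Vector (Vector Carrier n) n) →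
                    q y (λ i → q y (x i)) ≈ q y (λ i → x i i)
    -- z i is the entry written x^{i0} in the usual presentation.
    B3            : ∀ y (z : Vector Carrier n) (x : Vector (Vector Carrier n) n) →
                    q y (λ i → q (z i) (x i)) ≈
                    q (q y z) (λ j → q y (λ i → x i j))
    B4            : ∀ y → q y e ≈ y

  -- x ∧[ i ] y = q(x, y, …, y, e i, y, …, y), with e i in position i.
  meet : Fin n → Carrier → Carrier → Carrier
  meet i x y = q x (updateAt (replicate n y) i (const (e i)))

  infixr 7 meet
  syntax meet i x y = x ∧[ i ] y

module _ {n : ℕ} {c ℓ : Level} (A : nBA n c ℓ) where
  open nBA A

  record IsMultideal {p} (I : Fin n → Pred Carrier p) : Set (c ⊔ ℓ ⊔ p) where
    field
      -- A subset of a setoid is a predicate closed under its equality.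
      resp     : ∀ k → I k Respects _≈_
      disjoint : ∀ {j k} → j ≢ k → I j ⊥ I k
      m1       : ∀ k → e k ∈ I k
      m2       : ∀ {r k a b} → a ∈ I r → b ∈ I k → (y : Vector Carrier n) →
                 q a (updateAt y r (const b)) ∈ I k
      m3       : ∀ {k} a (y : Vector Carrier n) → (∀ j → y j ∈ I k) → q a y ∈ I k

  record IsUltramultideal {p} (I : Fin n → Pred Carrier p) : Set (c ⊔ ℓ ⊔ p) where
    field
      isMultideal : IsMultideal I
      covers      : Universal (⋃ (Fin n) I)

  record IsPrimeMultideal {p} (I : Fin n → Pred Carrier p) : Set (c ⊔ ℓ ⊔ p) where
    field
      isMultideal : IsMultideal I
      prime       : ∀ i x y → (x ∧[ i ] y) ∈ I i → x ∈ I i ⊎ y ∈ I i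

{-# OPTIONS --safe #-}
-- For the forward direction let b i = q(a, e i, …, e j, …, e i) with e j (j ≠ i)
-- in position i.  By (B2), a ∧[ i ] b i = e i, so primality gives a ∈ I i or
-- b i ∈ I i for each i.  If b i ∈ I i for all i, then (m2) applied to b i shows
-- that changing the i-th entry of y never moves q(a, y) out of the component I k
-- containing it.  Changing all entries of (e r, …, e r) to e s then puts
-- e s in I r, against disjointness.  Conversely, if x ∈ I j and y ∈ I k with
-- j ≠ i ≠ k, then x ∧[ i ] y ∈ I k by (m2), so it is not in I i.
module Submission where

open import Data.Nat.Base using (ℕ; _≤_; s≤s)
open import Data.Fin.Base using (Fin; zero; suc)
open import Data.Fin.Properties using (_≟_; sequence)
open import Data.Empty using (⊥-elim)
open import Data.List.Base using (List; []; _∷_; allFin)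
open import Data.List.Membership.Propositional using () renaming (_∈_ to _∈ₗ_)
open import Data.List.Membership.Propositional.Properties using (∈-allFin)
open import Data.List.Relation.Unary.Any using (here; there)
open import Data.Product.Base using (∃; _,_)
open import Data.Sum.Base using (_⊎_; inj₁; inj₂; [_,_]′)
import Data.Sum.Effectful.Left as Sumₗ
open import Data.Vec.Functional using (Vector; replicate; updateAt)
open import Data.Vec.Functional.Properties
  using (updateAt-updates; updateAt-minimal; updateAt-updateAt; updateAt-id-local)
open import Function.Base using (const; id)
open import Function.Bundles using (_⇔_; mk⇔)
open import Relation.Binary.Bundles using (Setoid)
open import Relation.Binary.PropositionalEquality
  using (_≡_; _≢_; _≗_; refl; sym; trans)
open import Relation.Binary.Structures using (IsEquivalence)
import Relation.Binary.Reasoning.Setoid as SetoidReasoning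
open import Relation.Nullary using (yes; no)
open import Relation.Unary using (Pred; _∈_)
open import Defs

∃≢ : ∀ {n} → 2 ≤ n → (i : Fin n) → ∃ λ j → j ≢ i
∃≢ (s≤s (s≤s _)) zero    = suc zero , λ ()
∃≢ (s≤s (s≤s _)) (suc _) = zero , λ ()

-- Nothing makes `P` decidable; finiteness of `Fin n` suffices, since `sequence` in the left-biased
-- sum stops at the first `inj₁`.
some⊎all : ∀ {n p} {P Q : Pred (Fin n) p} →
           (∀ i → P i ⊎ Q i) → ∃ P ⊎ (∀ i → Q i)
some⊎all {p = p} {P} {Q} P⊎Q =
  sequence (Sumₗ.applicative (∃ P) p) λ i → [ (λ Pi → inj₁ (i , Pi)) , inj₂ ]′ (P⊎Q i)

updateAt-const-id : ∀ {a} {A : Set a} {n} (x : A) (i : Fin n) →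
                    updateAt (replicate n x) i (const x) ≗ replicate n x
updateAt-const-id {n = n} x i = updateAt-id-local i (replicate n x) refl

module _ {a p} {A : Set a} {n : ℕ} {P : Pred (Vector A n) p}
         (resp   : ∀ {xs ys} → xs ≗ ys → P xs → P ys)
         (update : ∀ {xs} i v → P xs → P (updateAt xs i (const v)))
         (ys : Vector A n) where

  -- Generalised for induction: `is` holds the positions where `xs` may still differ from `ys`. The
  -- empty list leaves only pointwise agreement, hence `resp`.
  change-entries : (is : List (Fin n)) → ∀ {xs} →
                   (∀ k → k ∈ₗ is ⊎ xs k ≡ ys k) → P xs → P ys
  change-entries []       agree Pxs = resp (λ k → [ (λ ()) , id ]′ (agree k)) Pxs
  change-entries (i ∷ is) {xs} agree Pxs = change-entries is agree′ (update i (ys i) Pxs)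
    where
    agree′ : ∀ k → k ∈ₗ is ⊎ updateAt xs i (const (ys i)) k ≡ ys k
    agree′ k with k ≟ i | agree k
    ... | yes refl | _                  = inj₂ (updateAt-updates k xs)
    ... | no k≢i   | inj₁ (here k≡i)    = ⊥-elim (k≢i k≡i)
    ... | no k≢i   | inj₁ (there k∈is)  = inj₁ k∈is
    ... | no k≢i   | inj₂ xsk≡ysk       = inj₂ (trans (updateAt-minimal k i xs k≢i) xsk≡ysk)

  change-all-entries : ∀ {xs} → P xs → P ys
  change-all-entries = change-entries (allFin n) (λ k → inj₁ (∈-allFin k))

module _ {n c ℓ} (A : nBA n c ℓ) where
  open nBA A
  private module ≈ = IsEquivalence isEquivalence

  setoid : Setoid c ℓ
  setoid = record { isEquivalence = isEquivalence }

  open SetoidReasoning setoid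

  q-congʳ : ∀ a {xs ys} → xs ≗ ys → q a xs ≈ q a ys
  q-congʳ a xs≗ys = q-cong ≈.refl (λ k → ≈.reflexive (xs≗ys k))

  -- By (B1), `v` is itself `q a` of a constant vector. The left side is thus `q a` applied to the
  -- rows of a matrix with row `i` constantly `v` and all others `y`, and (B2) collapses it to the
  -- diagonal.
  q-updateAt-q : ∀ a y i v →
    q a (updateAt (replicate n (q a y)) i (const v)) ≈ q a (updateAt y i (const v))
  q-updateAt-q a y i v = begin
    q a (updateAt (replicate n (q a y)) i (const v))  ≈⟨ q-cong ≈.refl rows ⟨
    q a (λ k → q a (x k))                             ≈⟨ B2 a x ⟩
    q a (λ k → x k k)                                 ≈⟨ q-congʳ a diagonal ⟩
    q a (updateAt y i (const v))                      ∎
    where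
    x : Vector (Vector Carrier n) n
    x = updateAt (replicate n y) i (const (replicate n v))

    rows : ∀ k → q a (x k) ≈ updateAt (replicate n (q a y)) i (const v) k
    rows k with k ≟ i
    ... | yes refl
      rewrite updateAt-updates k {const (replicate n v)} (replicate n y)
            | updateAt-updates k {const v} (replicate n (q a y)) = B1 a v
    ... | no k≢i
      rewrite updateAt-minimal k i {const (replicate n v)} (replicate n y) k≢i
            | updateAt-minimal k i {const v} (replicate n (q a y)) k≢i = ≈.refl

    diagonal : ∀ k → x k k ≡ updateAt y i (const v) k
    diagonal k with k ≟ i
    ... | yes refl
      rewrite updateAt-updates k {const (replicate n v)} (replicate n y)
            | updateAt-updates k {const v} y = refl
    ... | no k≢i
      rewrite updateAt-minimal k i {const (replicate n v)} (replicate n y) k≢i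
            | updateAt-minimal k i {const v} y k≢i = refl

  -- This is (B3) for a matrix with all rows equal to `w`: its columns are constant, so (B1) removes
  -- the inner `q a`.
  q-q : ∀ a z w → q (q a z) w ≈ q a (λ k → q (z k) w)
  q-q a z w = begin
    q (q a z) w                                ≈⟨ q-cong ≈.refl (λ j → B1 a (w j)) ⟨
    q (q a z) (λ j → q a (replicate n (w j)))  ≈⟨ B3 a z (replicate n w) ⟨
    q a (λ k → q (z k) w)                      ∎

  -- A negation relative to `i`: by (B0) it sends `e i` to `e j` and every other `e k` to `e i`. For
  -- `n = 2` and `j ≢ i` it is Boolean complement.
  co : Fin n → Fin n → Carrier → Carrier
  co i j a = q a (updateAt (replicate n (e i)) i (const (e j)))

  -- The meet overwrites the `e j` in position `i` by `e i`, which leaves a constant vector for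
  -- (B1).
  meet-co : ∀ i j a → a ∧[ i ] co i j a ≈ e i
  meet-co i j a = begin
    a ∧[ i ] co i j a
      ≈⟨ q-updateAt-q a _ i (e i) ⟩
    q a (updateAt (updateAt (replicate n (e i)) i (const (e j))) i (const (e i)))
      ≈⟨ q-congʳ a (updateAt-updateAt i (replicate n (e i))) ⟩
    q a (updateAt (replicate n (e i)) i (const (e i)))
      ≈⟨ q-congʳ a (updateAt-const-id (e i) i) ⟩
    q a (replicate n (e i))
      ≈⟨ B1 a (e i) ⟩
    e i
      ∎

  -- Negating the first argument exchanges the two branches: after `q-q`, (B0) makes `e j` select
  -- `v`, because `j ≢ i`, and `e i` select `u`.
  q-co : ∀ {i j} → j ≢ i → ∀ a u v →
    q (co i j a) (updateAt (replicate n v) i (const u)) ≈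
    q a (updateAt (replicate n u) i (const v))
  q-co {i} {j} j≢i a u v = ≈.trans (q-q a z w) (q-cong ≈.refl entries)
    where
    z w : Vector Carrier n
    z = updateAt (replicate n (e i)) i (const (e j))
    w = updateAt (replicate n v) i (const u)

    entries : ∀ k → q (z k) w ≈ updateAt (replicate n u) i (const v) k
    entries k with k ≟ i
    ... | yes refl
      rewrite updateAt-updates k {const (e j)} (replicate n (e k))
            | updateAt-updates k {const v} (replicate n u) =
      ≈.trans (B0 j w) (≈.reflexive (updateAt-minimal j k (replicate n v) j≢i))
    ... | no k≢i
      rewrite updateAt-minimal k i {const (e j)} (replicate n (e i)) k≢i
            | updateAt-minimal k i {const v} (replicate n u) k≢i =
      ≈.trans (B0 i w) (≈.reflexive (updateAt-updates i (replicate n v)))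

  module _ {p} {I : Fin n → Pred Carrier p} (M : IsMultideal A I) where
    open IsMultideal M

    -- Apply (m2) to `co i j a` with `q a y` in slot `i` and `v` elsewhere. `q-co` moves `v` into
    -- slot `i`, and `q-updateAt-q` then absorbs the copies of `q a y`.
    co∈⇒update-entry : ∀ {i j a} → j ≢ i → co i j a ∈ I i →
      ∀ {k} y v → q a y ∈ I k → q a (updateAt y i (const v)) ∈ I k
    co∈⇒update-entry {i} {a = a} j≢i co∈ {k} y v qay∈ =
      resp k (≈.trans (q-co j≢i a (q a y) v) (q-updateAt-q a y i v))
        (m2 co∈ qay∈ (replicate n v))

    prime⇒covers : 2 ≤ n → IsPrimeMultideal A I → ∀ a → ∃ λ i → a ∈ I i
    -- Matching on `2≤n` exposes two successors in `n`, so that `zero` and `suc zero` serve as the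
    -- distinct indices `r` and `s`.
    prime⇒covers 2≤n@(s≤s (s≤s _)) P a with some⊎all a∈⊎co∈
      where
      a∈⊎co∈ : ∀ i → a ∈ I i ⊎ (let (j , _) = ∃≢ 2≤n i in co i j a ∈ I i)
      a∈⊎co∈ i = let (j , _) = ∃≢ 2≤n i in
        IsPrimeMultideal.prime P i a (co i j a) (resp i (≈.sym (meet-co i j a)) (m1 i))
    ... | inj₁ a∈  = a∈
    ... | inj₂ co∈ = ⊥-elim (disjoint {r} {s} (λ ()) (e-s∈I-r , m1 s))
      where
      r s : Fin n
      r = zero
      s = suc zero

      e-s∈I-r : e s ∈ I r
      e-s∈I-r = resp r (B1 a (e s))
        -- The invariant starts at the constant vector `e r`, where (B1) reduces it to (m1).
        (change-all-entries {P = λ y → q a y ∈ I r}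
          (λ xs≗ys → resp r (q-congʳ a xs≗ys))
          (λ {y} i v → let (_ , j≢i) = ∃≢ 2≤n i in co∈⇒update-entry j≢i (co∈ i) y v)
          (replicate n (e s))
          (resp r (≈.sym (B1 a (e r))) (m1 r)))

    -- Since `j ≢ i`, entry `j` of the meet's vector is already `y`; writing `y` there again changes
    -- nothing but gives the shape that (m2) expects.
    ∈⇒meet∈ : ∀ {i j k x y} → j ≢ i → x ∈ I j → y ∈ I k → (x ∧[ i ] y) ∈ I k
    ∈⇒meet∈ {i} {j} {k} {x} {y} j≢i x∈ y∈ =
      resp k (q-congʳ x (updateAt-id-local j w (sym (updateAt-minimal j i (replicate n y) j≢i))))
        (m2 x∈ y∈ w)
      where
      w : Vector Carrier n
      w = updateAt (replicate n y) i (const (e i))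

    covers⇒prime : (∀ a → ∃ λ i → a ∈ I i) →
                   ∀ i x y → (x ∧[ i ] y) ∈ I i → x ∈ I i ⊎ y ∈ I i
    covers⇒prime covers i x y meet∈ with covers x | covers y
    ... | j , x∈ | k , y∈ with j ≟ i | k ≟ i
    ... | yes refl | _        = inj₁ x∈
    ... | no _     | yes refl = inj₂ y∈
    ... | no j≢i   | no k≢i   = ⊥-elim (disjoint k≢i (∈⇒meet∈ j≢i x∈ y∈ , meet∈))

proposition7p13 : ∀ {n c ℓ p} → 2 ≤ n → (A : nBA n c ℓ) →
    (I : Fin n → Pred (nBA.Carrier A) p) → IsMultideal A I →
    IsPrimeMultideal A I ⇔ IsUltramultideal A I
proposition7p13 2≤n A I M = mk⇔
  (λ P → record { isMultideal = M ; covers = prime⇒covers A M 2≤n P })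
  (λ U → record { isMultideal = M ; prime = covers⇒prime A M (IsUltramultideal.covers U) })
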